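{- $\mathrm{bal}_3(n,P_6)=\left(\tfrac{1}{2}+o(1)\right)n$ as $n\to\infty$.
   Context: $P_m$ denotes the path with $m$ edges. A $3$-edge-colored graph $G$ is balanced if each of the $3$ colors appears on either $\lfloor e(G)/3\rfloor$ or $\lceil e(G)/3\rceil$ edges (so a balanced $P_6$ has exactly $2$ edges of each color). $\mathrm{bal}_3(n,G)$ is the minimum integer $m$ (if it exists) such that every $3$-edge-coloring of $K_n$ with more than $m$ edges in each of the $3$ colors contains a balanced copy of $G$; if no such $m$ exists it is $\infty$. -}

module Defs where

open import Data.Nat using (ℕ; _+_; _*_; _<_; _≤_)
open import Data.Fin using (Fin; zero; suc; inject₁) renaming (_<_ to _<ᶠ_)
open import Data.Fin.Properties using (_≟_) renaming (_<?_ to _<ᶠ?_)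
open import Data.List using (List; length; filter; allFin; cartesianProduct)
open import Data.Product using (Σ; _×_; _,_; proj₁; proj₂; ∃-syntax)
open import Relation.Binary.PropositionalEquality using (_≡_)
open import Relation.Nullary using (¬_)
open import Relation.Nullary.Decidable using (_×-dec_)
open import Function.Definitions using (Injective)

-- A 3-edge-colouring of the complete graph K_n on vertex set Fin n:
-- a symmetric colour function (the value on the diagonal is irrelevant).
Colouring : ℕ → Set
Colouring n = Σ (Fin n → Fin n → Fin 3) λ c → ∀ i j → c i j ≡ c j i

colourCount : ∀ {n} → Colouring n → Fin 3 → ℕ
colourCount {n} (c , _) a =
  length (filter (λ p → (proj₁ p <ᶠ? proj₂ p) ×-dec (c (proj₁ p) (proj₂ p) ≟ a))
                 (cartesianProduct (allFin n) (allFin n)))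

HasBalancedP6 : ∀ {n} → Colouring n → Set
HasBalancedP6 {n} (c , _) =
  ∃[ v ] (Injective {A = Fin 7} {B = Fin n} _≡_ _≡_ v ×
          (∀ (a : Fin 3) →
             length (filter (λ (i : Fin 6) → c (v (inject₁ i)) (v (suc i)) ≟ a)
                            (allFin 6)) ≡ 2))

BalBound : ℕ → ℕ → Set
BalBound n m = (col : Colouring n) → (∀ a → m < colourCount col a) → HasBalancedP6 col

IsBal3P6 : ℕ → ℕ → Set
IsBal3P6 n m = BalBound n m × (∀ m' → m' < m → ¬ BalBound n m')

{-# OPTIONS --safe #-}
module Submission where

-- Lower bound: colour the edges at one vertex half blue and half green and all others red. A path
-- uses at most two edges at that vertex, so it cannot contain two blue and two green edges.
--
-- Upper bound: n/2 + O(1) edges of each colour suffice. Call v a centre of a colour if at least a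
-- constant number of edges of that colour meet v. A colour with a centre has cherries (two-edge
-- paths) at it, and a colour without centres has more than n/2 edges left after deleting boundedly
-- many vertices, hence a cherry avoiding them. No vertex carries more than n edges, so two colours
-- cannot both be concentrated at one vertex. A case analysis on coinciding centres then yields one
-- of four vertex-disjoint configurations of bounded size, and in each of them a balanced P₆ is
-- found by asking for the colours of a few further edges.
--
-- The minimum exists because only finitely many colourings of Kₙ have to be inspected.

open import Defs
open import Algebra.Properties.CommutativeSemigroup using (interchange; x∙yz≈y∙xz)
open import Data.Empty using (⊥)
open import Data.Fin as Fin using (Fin; zero; suc; inject₁; inject≤; toℕ; fromℕ<; finToFun; funToFin)
open import Data.Fin.Properties using (_≟_; any?; all?; <⇒≢; <-asym; injective⇒≤; suc-injective; toℕ<n; toℕ-injective; toℕ-inject≤; inject≤-injective; toℕ-fromℕ<; finToFun-funToFin) renaming (_<?_ to _<ᶠ?_)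
open import Data.List using (List; []; _∷_; _++_; length; lookup; filter; allFin; tabulate; cartesianProduct; concatMap)
open import Data.List.Membership.Propositional using (_∈_; _∉_; find)
open import Data.List.Membership.Propositional.Properties using (∈-lookup; ∈-allFin; ∈-filter⁺; ∈-filter⁻; ∈-++⁺ˡ; ∈-++⁺ʳ; ∈-++⁻; ∈-tabulate⁻; ∈-cartesianProduct⁺)
open import Data.List.Properties using (filter-≐; length-++; length-tabulate)
open import Data.List.Relation.Unary.All as All using (All; []; _∷_)
open import Data.List.Relation.Unary.All.Properties using (¬Any⇒All¬; ¬All⇒Any¬)
open import Data.List.Relation.Unary.AllPairs using ([]; _∷_)
open import Data.List.Relation.Unary.Any using (here; there; index)
open import Data.List.Relation.Unary.Any.Properties using (lookup-index)
open import Data.List.Relation.Unary.Unique.Propositional using (Unique)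
open import Data.List.Relation.Unary.Unique.Propositional.Properties using (filter⁺; allFin⁺; cartesianProduct⁺; tabulate⁺; ++⁺)
open import Data.Nat as ℕ using (ℕ; zero; suc; _+_; _*_; _≤_; _<_; s≤s; z≤n; _<?_; _≤?_; ⌊_/2⌋)
open import Data.Nat.Induction using (<-rec)
open import Data.Nat.Properties hiding (_≟_; suc-injective; <⇒≢; <-asym)
open import Data.Product using (_×_; _,_; proj₁; proj₂; ∃-syntax; map₂)
open import Data.Product.Properties using (≡-dec; ,-injectiveʳ)
open import Data.Sum using (_⊎_; inj₁; inj₂; [_,_]′; swap)
open import Data.Unit using (⊤; tt)
open import Data.Vec as Vec using (Vec; []; _∷_)
open import Function using (_∘_; id)
open import Function.Definitions using (Injective)
open import Level using (0ℓ)
open import Relation.Binary.PropositionalEquality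
open import Relation.Nullary using (¬_; Dec; yes; no; contradiction)
open import Relation.Nullary.Decidable using (True; toWitness; toSum; map′; ¬?; _×-dec_; _⊎-dec_; _→-dec_)
open import Relation.Unary using (Pred; Decidable)
import Data.List.Membership.DecPropositional as DecMembership

-- Counting with duplicate-free lists

lookup-injective : ∀ {A : Set} {xs : List A} → Unique xs → Injective _≡_ _≡_ (lookup xs)
lookup-injective (x≢ ∷ _) {zero}  {zero}  _  = refl
lookup-injective (x≢ ∷ _) {zero}  {suc j} eq = contradiction eq (All.lookup x≢ (∈-lookup j))
lookup-injective (x≢ ∷ _) {suc i} {zero}  eq = contradiction (sym eq) (All.lookup x≢ (∈-lookup i))
lookup-injective (_ ∷ u)  {suc i} {suc j} eq = cong suc (lookup-injective u eq)

-- Pigeonhole on positions: a position in `xs` goes to the position of its image in `ys`, and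
-- `lookup` is injective on a duplicate-free list.
injectiveOn⇒length≤ : ∀ {A B : Set} {xs : List A} {ys : List B} (f : A → B) → Unique xs →
                      (∀ {x} → x ∈ xs → f x ∈ ys) →
                      (∀ {x y} → x ∈ xs → y ∈ xs → f x ≡ f y → x ≡ y) → length xs ≤ length ys
injectiveOn⇒length≤ {xs = xs} {ys} f u into f-inj = injective⇒≤ pos-inj
  where
  pos : Fin (length xs) → Fin (length ys)
  pos i = index (into (∈-lookup i))
  pos-inj : Injective _≡_ _≡_ pos
  pos-inj {i} {j} eq = lookup-injective u (f-inj (∈-lookup i) (∈-lookup j) (begin
    f (lookup xs i)   ≡⟨ lookup-index (into (∈-lookup i)) ⟩
    lookup ys (pos i) ≡⟨ cong (lookup ys) eq ⟩
    lookup ys (pos j) ≡⟨ lookup-index (into (∈-lookup j)) ⟨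
    f (lookup xs j)   ∎))
    where open ≡-Reasoning

unique-⊆⇒length≤ : ∀ {A : Set} {xs ys : List A} → Unique xs →
                   (∀ {x} → x ∈ xs → x ∈ ys) → length xs ≤ length ys
unique-⊆⇒length≤ u xs⊆ys = injectiveOn⇒length≤ id u xs⊆ys (λ _ _ eq → eq)

length≤filter+filter : ∀ {A : Set} {P Q : Pred A 0ℓ} (P? : Decidable P) (Q? : Decidable Q) →
                       (∀ x → P x ⊎ Q x) → ∀ xs →
                       length xs ≤ length (filter P? xs) + length (filter Q? xs)
length≤filter+filter P? Q? P∪Q []       = z≤n
length≤filter+filter P? Q? P∪Q (x ∷ xs) with ih ← length≤filter+filter P? Q? P∪Q xs | P? x | Q? x
... | yes _ | yes _ = s≤s (≤-trans ih (+-monoʳ-≤ _ (n≤1+n _)))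
... | yes _ | no  _ = s≤s ih
... | no  _ | yes _ = subst (suc (length xs) ≤_) (sym (+-suc (length (filter P? xs)) _)) (s≤s ih)
... | no ¬p | no ¬q = contradiction (P∪Q x) [ ¬p , ¬q ]′

unique⇒length≤ : ∀ {n} {xs : List (Fin n)} → Unique xs → length xs ≤ n
unique⇒length≤ {n} {xs} xs! =
  subst (length xs ≤_) (length-tabulate {n = n} id) (unique-⊆⇒length≤ xs! (λ {x} _ → ∈-allFin x))

infix 4 _#_
_#_ : ∀ {A : Set} → List A → List A → Set
xs # ys = All (_∉ ys) xs

module _ {A : Set} where
  #-sym : {xs ys : List A} → xs # ys → ys # xs
  #-sym xs#ys = All.tabulate λ y∈ys y∈xs → All.lookup xs#ys y∈xs y∈ys

  #-++ : {xs ys zs : List A} → xs # ys → xs # zs → xs # (ys ++ zs)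
  #-++ {ys = ys} p q = All.zipWith (λ (∉ys , ∉zs) → [ ∉ys , ∉zs ]′ ∘ ∈-++⁻ ys) (p , q)

  #-++ˡ : {xs ys zs : List A} → xs # (ys ++ zs) → xs # ys
  #-++ˡ = All.map (λ ∉ → ∉ ∘ ∈-++⁺ˡ)

  #-++ʳ : {xs zs : List A} (ys : List A) → xs # (ys ++ zs) → xs # zs
  #-++ʳ ys = All.map (λ ∉ → ∉ ∘ ∈-++⁺ʳ ys)

  unique-++ : {xs ys : List A} → Unique xs → Unique ys → xs # ys → Unique (xs ++ ys)
  unique-++ xs! ys! xs#ys = ++⁺ xs! ys! (λ (∈xs , ∈ys) → All.lookup xs#ys ∈xs ∈ys)

-- Certified configurations

Rainbow : Fin 3 → Fin 3 → Fin 3 → Set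
Rainbow a b c = Unique (a ∷ b ∷ c ∷ [])

palette : Fin 3 → Fin 3 → Fin 3 → Fin 3 → Fin 3
palette a b c = lookup (a ∷ b ∷ c ∷ [])

-- A colour outside the three would give four distinct elements of `Fin 3`.
palette-surjective : ∀ {a b c} → Rainbow a b c → ∀ x → ∃[ k ] palette a b c k ≡ x
palette-surjective {a} {b} {c} u x with x ∈? (a ∷ b ∷ c ∷ [])
  where open DecMembership {A = Fin 3} _≟_
... | yes x∈ = index x∈ , sym (lookup-index x∈)
... | no  x∉ = contradiction (unique⇒length≤ (¬Any⇒All¬ _ x∉ ∷ u)) 1+n≰n

Fact : ℕ → Set
Fact s = Fin s × Fin s × Fin 3

-- Vertices and colours of facts and strategies are indices, into a list of distinct vertices and
-- into a palette of three distinct colours. A strategy is a decision tree that asks for colours of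
-- edges, with one subtree per answer, until a balanced path is known.
data Strategy (s : ℕ) : Set where
  path  : Vec (Fin s) 7 → Strategy s
  query : Fin s → Fin s → (t₀ t₁ t₂ : Strategy s) → Strategy s

private variable s : ℕ

-- Edges are unordered, while a fact stores an edge in one orientation.
Knows : List (Fact s) → Fin s → Fin s → Fin 3 → Set
Knows Γ i j k = (i , j , k) ∈ Γ ⊎ (j , i , k) ∈ Γ

knows? : ∀ (Γ : List (Fact s)) i j k → Dec (Knows Γ i j k)
knows? Γ i j k = (i , j , k) ∈? Γ ⊎-dec (j , i , k) ∈? Γ
  where open DecMembership (≡-dec _≟_ (≡-dec _≟_ _≟_))

module _ (Γ : List (Fact s)) (p : Vec (Fin s) 7) where

  StepColour : Fin 6 → Fin 3 → Set
  StepColour i k = Knows Γ (Vec.lookup p (inject₁ i)) (Vec.lookup p (suc i)) k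

  stepColour? : ∀ i k → Dec (StepColour i k)
  stepColour? i k = knows? Γ (Vec.lookup p (inject₁ i)) (Vec.lookup p (suc i)) k

  -- The last condition counts known colours. Since every step has a known colour, and true facts
  -- cannot give one step two colours, these counts are the actual ones.
  BalancedPath : Set
  BalancedPath = (∀ i j → Vec.lookup p i ≡ Vec.lookup p j → i ≡ j)
               × (∀ i → ∃[ k ] StepColour i k)
               × (∀ k → length (filter (λ i → stepColour? i k) (allFin 6)) ≡ 2)

  balancedPath? : Dec BalancedPath
  balancedPath? =
          all? (λ i → all? λ j → (Vec.lookup p i ≟ Vec.lookup p j) →-dec (i ≟ j))
    ×-dec all? (λ i → any? (stepColour? i))
    ×-dec all? (λ k → length (filter (λ i → stepColour? i k) (allFin 6)) ℕ.≟ 2)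

Wins : List (Fact s) → Strategy s → Set
Wins Γ (path p)             = BalancedPath Γ p
Wins Γ (query i j t₀ t₁ t₂) = Wins ((i , j , zero) ∷ Γ) t₀
                            × Wins ((i , j , suc zero) ∷ Γ) t₁
                            × Wins ((i , j , suc (suc zero)) ∷ Γ) t₂

wins? : ∀ (Γ : List (Fact s)) t → Dec (Wins Γ t)
wins? Γ (path p)             = balancedPath? Γ p
wins? Γ (query i j t₀ t₁ t₂) = wins? _ t₀ ×-dec wins? _ t₁ ×-dec wins? _ t₂

module _ {n : ℕ} (colouring : Colouring n) {a b c : Fin 3} (rainbow : Rainbow a b c)
         {vs : List (Fin n)} (vs! : Unique vs) where

  private
    col = proj₁ colouring
    col-sym = proj₂ colouring

  Holds : Fact (length vs) → Set
  Holds (i , j , k) = col (lookup vs i) (lookup vs j) ≡ palette a b c k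

  knows-sound : ∀ {Γ} → All Holds Γ → ∀ {i j k} → Knows Γ i j k → Holds (i , j , k)
  knows-sound hs (inj₁ ∈Γ) = All.lookup hs ∈Γ
  knows-sound hs (inj₂ ∈Γ) = trans (col-sym _ _) (All.lookup hs ∈Γ)

  -- Induction on the tree: the actual colour of a queried edge is a palette entry, which selects
  -- the branch to follow and makes the added fact true.
  wins-sound : ∀ {Γ} t → All Holds Γ → Wins Γ t → HasBalancedP6 colouring
  wins-sound {Γ} (path p) hs (p-inj , known , twice) = v , v-inj , count
    where
    v : Fin 7 → Fin n
    v i = lookup vs (Vec.lookup p i)
    v-inj : Injective _≡_ _≡_ v
    v-inj eq = p-inj _ _ (lookup-injective vs! eq)
    count : ∀ x → length (filter (λ i → col (v (inject₁ i)) (v (suc i)) ≟ x) (allFin 6)) ≡ 2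
    count x with k , refl ← palette-surjective rainbow x =
      trans (cong length (filter-≐ (λ i → col (v (inject₁ i)) (v (suc i)) ≟ palette a b c k)
                                   (λ i → stepColour? Γ p i k) (to , knows-sound hs) (allFin 6)))
            (twice k)
      where
      to : ∀ {i} → col (v (inject₁ i)) (v (suc i)) ≡ palette a b c k → StepColour Γ p i k
      -- The step has some known colour `l`; as that fact is true and the palette is injective, `l`
      -- is `k`.
      to {i} eq with l , know ← known i =
        subst (StepColour Γ p i) (lookup-injective rainbow (trans (sym (knows-sound hs know)) eq)) know
  wins-sound (query i j t₀ t₁ t₂) hs (w₀ , w₁ , w₂)
    with palette-surjective rainbow (col (lookup vs i) (lookup vs j))
  ... | zero            , eq = wins-sound t₀ (sym eq ∷ hs) w₀
  ... | suc zero        , eq = wins-sound t₁ (sym eq ∷ hs) w₁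
  ... | suc (suc zero)  , eq = wins-sound t₂ (sym eq ∷ hs) w₂

-- Since `wins` is the truth of a decision, a concrete certificate is verified by evaluating the
-- checker, and `tt` suffices as proof.
record Certificate (s : ℕ) : Set where
  field
    facts    : List (Fact s)
    strategy : Strategy s
    wins     : True (wins? facts strategy)

certificate-sound : ∀ {n} (colouring : Colouring n) {a b c : Fin 3} (rainbow : Rainbow a b c)
                    {vs : List (Fin n)} (vs! : Unique vs) (cert : Certificate (length vs)) →
                    All (Holds colouring rainbow vs!) (Certificate.facts cert) → HasBalancedP6 colouring
certificate-sound colouring rainbow vs! cert hs =
  wins-sound colouring rainbow vs! strategy hs (toWitness wins)
  where open Certificate cert

-- The four strategies were found by computer search.
module Certificates where
  open import Agda.Builtin.FromNat using (Number; fromNat)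
  import Data.Fin.Literals as FinLiterals
  import Data.Nat.Literals as ℕLiterals

  private instance
    trivial : ⊤
    trivial = tt
    finNumber : ∀ {m} → Number (Fin m)
    finNumber {m} = FinLiterals.number m
    ℕNumber : Number ℕ
    ℕNumber = ℕLiterals.number

  threeCherriesCertificate : Certificate 9
  threeCherriesCertificate = record
    { facts = (0 , 1 , 0) ∷ (1 , 2 , 0) ∷ (3 , 4 , 1) ∷ (4 , 5 , 1) ∷ (6 , 7 , 2) ∷ (7 , 8 , 2) ∷ []
    ; wins  = tt
    ; strategy =
        query 2 8
          (query 3 6
            (path (2 ∷ 8 ∷ 7 ∷ 6 ∷ 3 ∷ 4 ∷ 5 ∷ []))
            (path (1 ∷ 2 ∷ 8 ∷ 7 ∷ 6 ∷ 3 ∷ 4 ∷ []))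
            (query 1 5
              (path (0 ∷ 1 ∷ 5 ∷ 4 ∷ 3 ∷ 6 ∷ 7 ∷ []))
              (path (4 ∷ 5 ∷ 1 ∷ 2 ∷ 8 ∷ 7 ∷ 6 ∷ []))
              (path (6 ∷ 3 ∷ 4 ∷ 5 ∷ 1 ∷ 2 ∷ 8 ∷ []))))
          (query 5 6
            (path (1 ∷ 2 ∷ 8 ∷ 7 ∷ 6 ∷ 5 ∷ 4 ∷ []))
            (path (0 ∷ 1 ∷ 2 ∷ 8 ∷ 7 ∷ 6 ∷ 5 ∷ []))
            (query 0 3
              (path (1 ∷ 0 ∷ 3 ∷ 4 ∷ 5 ∷ 6 ∷ 7 ∷ []))
              (path (3 ∷ 0 ∷ 1 ∷ 2 ∷ 8 ∷ 7 ∷ 6 ∷ []))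
              (path (4 ∷ 3 ∷ 0 ∷ 1 ∷ 2 ∷ 8 ∷ 7 ∷ []))))
          (query 0 3
            (query 5 7
              (path (1 ∷ 2 ∷ 8 ∷ 7 ∷ 5 ∷ 4 ∷ 3 ∷ []))
              (path (0 ∷ 1 ∷ 2 ∷ 8 ∷ 7 ∷ 5 ∷ 4 ∷ []))
              (path (1 ∷ 0 ∷ 3 ∷ 4 ∷ 5 ∷ 7 ∷ 6 ∷ [])))
            (path (4 ∷ 3 ∷ 0 ∷ 1 ∷ 2 ∷ 8 ∷ 7 ∷ []))
            (path (5 ∷ 4 ∷ 3 ∷ 0 ∷ 1 ∷ 2 ∷ 8 ∷ [])))
    }

  twoCherriesTwoEdgesCertificate : Certificate 10
  twoCherriesTwoEdgesCertificate = record
    { facts = (0 , 1 , 0) ∷ (2 , 3 , 0) ∷ (4 , 5 , 1) ∷ (5 , 6 , 1) ∷ (7 , 8 , 2) ∷ (8 , 9 , 2) ∷ []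
    ; wins  = tt
    ; strategy =
        query 4 9
          (query 3 6
            (path (3 ∷ 6 ∷ 5 ∷ 4 ∷ 9 ∷ 8 ∷ 7 ∷ []))
            (query 6 7
              (path (3 ∷ 6 ∷ 7 ∷ 8 ∷ 9 ∷ 4 ∷ 5 ∷ []))
              (path (2 ∷ 3 ∷ 6 ∷ 7 ∷ 8 ∷ 9 ∷ 4 ∷ []))
              (query 3 7
                (path (4 ∷ 9 ∷ 8 ∷ 7 ∷ 3 ∷ 6 ∷ 5 ∷ []))
                (path (2 ∷ 3 ∷ 7 ∷ 8 ∷ 9 ∷ 4 ∷ 5 ∷ []))
                (path (2 ∷ 3 ∷ 7 ∷ 6 ∷ 5 ∷ 4 ∷ 9 ∷ []))))
            (path (2 ∷ 3 ∷ 6 ∷ 5 ∷ 4 ∷ 9 ∷ 8 ∷ [])))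
          (query 3 7
            (path (2 ∷ 3 ∷ 7 ∷ 8 ∷ 9 ∷ 4 ∷ 5 ∷ []))
            (query 1 2
              (path (1 ∷ 2 ∷ 3 ∷ 7 ∷ 8 ∷ 9 ∷ 4 ∷ []))
              (path (0 ∷ 1 ∷ 2 ∷ 3 ∷ 7 ∷ 8 ∷ 9 ∷ []))
              (query 0 4
                (path (0 ∷ 4 ∷ 9 ∷ 8 ∷ 7 ∷ 3 ∷ 2 ∷ []))
                (path (4 ∷ 0 ∷ 1 ∷ 2 ∷ 3 ∷ 7 ∷ 8 ∷ []))
                (path (5 ∷ 4 ∷ 0 ∷ 1 ∷ 2 ∷ 3 ∷ 7 ∷ []))))
            (query 2 4
              (path (6 ∷ 5 ∷ 4 ∷ 2 ∷ 3 ∷ 7 ∷ 8 ∷ []))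
              (query 1 8
                (path (1 ∷ 8 ∷ 7 ∷ 3 ∷ 2 ∷ 4 ∷ 5 ∷ []))
                (path (0 ∷ 1 ∷ 8 ∷ 7 ∷ 3 ∷ 2 ∷ 4 ∷ []))
                (path (0 ∷ 1 ∷ 8 ∷ 9 ∷ 4 ∷ 2 ∷ 3 ∷ [])))
              (query 1 3
                (query 6 8
                  (path (7 ∷ 3 ∷ 2 ∷ 4 ∷ 5 ∷ 6 ∷ 8 ∷ []))
                  (path (0 ∷ 1 ∷ 3 ∷ 7 ∷ 8 ∷ 6 ∷ 5 ∷ []))
                  (path (1 ∷ 3 ∷ 2 ∷ 4 ∷ 5 ∷ 6 ∷ 8 ∷ [])))
                (path (0 ∷ 1 ∷ 3 ∷ 2 ∷ 4 ∷ 9 ∷ 8 ∷ []))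
                (path (0 ∷ 1 ∷ 3 ∷ 2 ∷ 4 ∷ 5 ∷ 6 ∷ [])))))
          (query 3 6
            (path (2 ∷ 3 ∷ 6 ∷ 5 ∷ 4 ∷ 9 ∷ 8 ∷ []))
            (query 2 9
              (path (5 ∷ 6 ∷ 3 ∷ 2 ∷ 9 ∷ 8 ∷ 7 ∷ []))
              (query 1 3
                (query 5 7
                  (path (5 ∷ 7 ∷ 8 ∷ 9 ∷ 2 ∷ 3 ∷ 6 ∷ []))
                  (path (1 ∷ 3 ∷ 2 ∷ 9 ∷ 8 ∷ 7 ∷ 5 ∷ []))
                  (path (0 ∷ 1 ∷ 3 ∷ 6 ∷ 5 ∷ 7 ∷ 8 ∷ [])))
                (path (0 ∷ 1 ∷ 3 ∷ 2 ∷ 9 ∷ 8 ∷ 7 ∷ []))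
                (path (0 ∷ 1 ∷ 3 ∷ 2 ∷ 9 ∷ 4 ∷ 5 ∷ [])))
              (query 1 5
                (path (1 ∷ 5 ∷ 6 ∷ 3 ∷ 2 ∷ 9 ∷ 8 ∷ []))
                (path (0 ∷ 1 ∷ 5 ∷ 4 ∷ 9 ∷ 2 ∷ 3 ∷ []))
                (path (0 ∷ 1 ∷ 5 ∷ 6 ∷ 3 ∷ 2 ∷ 9 ∷ []))))
            (query 1 2
              (path (1 ∷ 2 ∷ 3 ∷ 6 ∷ 5 ∷ 4 ∷ 9 ∷ []))
              (query 0 8
                (path (2 ∷ 1 ∷ 0 ∷ 8 ∷ 9 ∷ 4 ∷ 5 ∷ []))
                (path (6 ∷ 3 ∷ 2 ∷ 1 ∷ 0 ∷ 8 ∷ 7 ∷ []))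
                (path (5 ∷ 6 ∷ 3 ∷ 2 ∷ 1 ∷ 0 ∷ 8 ∷ [])))
              (path (0 ∷ 1 ∷ 2 ∷ 3 ∷ 6 ∷ 5 ∷ 4 ∷ []))))
    }

  -- Vertex 12 is the centre, with leaves 8 to 11; the four edges on 0 to 7 form the two matchings.
  -- The order is that in which `starTwoMatchings` prepends vertices.
  starTwoMatchingsCertificate : Certificate 13
  starTwoMatchingsCertificate = record
    { facts = (0 , 1 , 0) ∷ (2 , 3 , 0) ∷ (4 , 5 , 1) ∷ (6 , 7 , 1) ∷
              (8 , 12 , 0) ∷ (9 , 12 , 1) ∷ (10 , 12 , 2) ∷ (11 , 12 , 2) ∷ []
    ; wins  = tt
    ; strategy =
        query 3 10
          (query 2 4
            (query 5 10
              (query 5 11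
                (query 7 11
                  (path (4 ∷ 5 ∷ 10 ∷ 12 ∷ 11 ∷ 7 ∷ 6 ∷ []))
                  (path (2 ∷ 3 ∷ 10 ∷ 12 ∷ 11 ∷ 7 ∷ 6 ∷ []))
                  (query 2 6
                    (path (3 ∷ 2 ∷ 6 ∷ 7 ∷ 11 ∷ 12 ∷ 9 ∷ []))
                    (path (7 ∷ 6 ∷ 2 ∷ 3 ∷ 10 ∷ 12 ∷ 11 ∷ []))
                    (path (7 ∷ 6 ∷ 2 ∷ 3 ∷ 10 ∷ 12 ∷ 9 ∷ []))))
                (path (3 ∷ 2 ∷ 4 ∷ 5 ∷ 11 ∷ 12 ∷ 10 ∷ []))
                (path (3 ∷ 2 ∷ 4 ∷ 5 ∷ 11 ∷ 12 ∷ 9 ∷ [])))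
              (path (3 ∷ 2 ∷ 4 ∷ 5 ∷ 10 ∷ 12 ∷ 11 ∷ []))
              (path (3 ∷ 2 ∷ 4 ∷ 5 ∷ 10 ∷ 12 ∷ 9 ∷ [])))
            (path (5 ∷ 4 ∷ 2 ∷ 3 ∷ 10 ∷ 12 ∷ 11 ∷ []))
            (path (5 ∷ 4 ∷ 2 ∷ 3 ∷ 10 ∷ 12 ∷ 9 ∷ [])))
          (query 2 4
            (path (5 ∷ 4 ∷ 2 ∷ 3 ∷ 10 ∷ 12 ∷ 11 ∷ []))
            (query 3 11
              (path (5 ∷ 4 ∷ 2 ∷ 3 ∷ 11 ∷ 12 ∷ 10 ∷ []))
              (query 5 10
                (path (3 ∷ 2 ∷ 4 ∷ 5 ∷ 10 ∷ 12 ∷ 11 ∷ []))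
                (query 1 11
                  (path (0 ∷ 1 ∷ 11 ∷ 12 ∷ 10 ∷ 5 ∷ 4 ∷ []))
                  (path (0 ∷ 1 ∷ 11 ∷ 12 ∷ 10 ∷ 3 ∷ 2 ∷ []))
                  (query 0 4
                    (path (5 ∷ 4 ∷ 0 ∷ 1 ∷ 11 ∷ 12 ∷ 9 ∷ []))
                    (path (5 ∷ 4 ∷ 0 ∷ 1 ∷ 11 ∷ 12 ∷ 8 ∷ []))
                    (path (1 ∷ 0 ∷ 4 ∷ 5 ∷ 10 ∷ 12 ∷ 8 ∷ []))))
                (path (3 ∷ 2 ∷ 4 ∷ 5 ∷ 10 ∷ 12 ∷ 8 ∷ [])))
              (path (5 ∷ 4 ∷ 2 ∷ 3 ∷ 11 ∷ 12 ∷ 8 ∷ [])))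
            (path (5 ∷ 4 ∷ 2 ∷ 3 ∷ 10 ∷ 12 ∷ 8 ∷ [])))
          (query 2 4
            (path (5 ∷ 4 ∷ 2 ∷ 3 ∷ 10 ∷ 12 ∷ 9 ∷ []))
            (path (5 ∷ 4 ∷ 2 ∷ 3 ∷ 10 ∷ 12 ∷ 8 ∷ []))
            (query 3 11
              (path (5 ∷ 4 ∷ 2 ∷ 3 ∷ 11 ∷ 12 ∷ 9 ∷ []))
              (path (5 ∷ 4 ∷ 2 ∷ 3 ∷ 11 ∷ 12 ∷ 8 ∷ []))
              (query 5 10
                (path (3 ∷ 2 ∷ 4 ∷ 5 ∷ 10 ∷ 12 ∷ 9 ∷ []))
                (path (3 ∷ 2 ∷ 4 ∷ 5 ∷ 10 ∷ 12 ∷ 8 ∷ []))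
                (query 7 8
                  (path (4 ∷ 5 ∷ 10 ∷ 12 ∷ 8 ∷ 7 ∷ 6 ∷ []))
                  (path (2 ∷ 3 ∷ 11 ∷ 12 ∷ 8 ∷ 7 ∷ 6 ∷ []))
                  (query 1 9
                    (path (0 ∷ 1 ∷ 9 ∷ 12 ∷ 10 ∷ 5 ∷ 4 ∷ []))
                    (path (0 ∷ 1 ∷ 9 ∷ 12 ∷ 11 ∷ 3 ∷ 2 ∷ []))
                    (path (0 ∷ 1 ∷ 9 ∷ 12 ∷ 8 ∷ 7 ∷ 6 ∷ [])))))))
    }

  -- The centres are 8 and 9. They share colour 0, and each has two leaves in that colour and two in
  -- a colour of its own.
  twoStarsCertificate : Certificate 10
  twoStarsCertificate = record
    { facts = (0 , 9 , 0) ∷ (1 , 9 , 0) ∷ (2 , 9 , 2) ∷ (3 , 9 , 2) ∷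
              (4 , 8 , 1) ∷ (5 , 8 , 1) ∷ (6 , 8 , 0) ∷ (7 , 8 , 0) ∷ []
    ; wins  = tt
    ; strategy =
        query 2 5
          (query 1 3
            (path (1 ∷ 3 ∷ 9 ∷ 2 ∷ 5 ∷ 8 ∷ 4 ∷ []))
            (path (1 ∷ 3 ∷ 9 ∷ 2 ∷ 5 ∷ 8 ∷ 6 ∷ []))
            (path (3 ∷ 1 ∷ 9 ∷ 2 ∷ 5 ∷ 8 ∷ 4 ∷ [])))
          (query 3 6
            (path (4 ∷ 8 ∷ 6 ∷ 3 ∷ 9 ∷ 2 ∷ 5 ∷ []))
            (path (5 ∷ 2 ∷ 9 ∷ 3 ∷ 6 ∷ 8 ∷ 7 ∷ []))
            (path (0 ∷ 9 ∷ 2 ∷ 5 ∷ 8 ∷ 6 ∷ 3 ∷ [])))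
          (query 1 2
            (path (3 ∷ 9 ∷ 1 ∷ 2 ∷ 5 ∷ 8 ∷ 4 ∷ []))
            (path (3 ∷ 9 ∷ 1 ∷ 2 ∷ 5 ∷ 8 ∷ 6 ∷ []))
            (path (0 ∷ 9 ∷ 1 ∷ 2 ∷ 5 ∷ 8 ∷ 4 ∷ [])))
    }

-- Edges, degrees and cherries

module Graph {n : ℕ} (colouring : Colouring n) where
  open DecMembership {A = Fin n} _≟_ using (_∈?_; _∉?_)

  private
    V = Fin n
    col = proj₁ colouring
    col-sym = proj₂ colouring

  -- The list inside `colourCount` is repeated verbatim, so that its length is `colourCount` by
  -- computation.
  edges : Fin 3 → List (V × V)
  edges a = filter (λ p → (proj₁ p <ᶠ? proj₂ p) ×-dec (col (proj₁ p) (proj₂ p) ≟ a))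
                   (cartesianProduct (allFin n) (allFin n))

  edges! : ∀ a → Unique (edges a)
  edges! a = filter⁺ _ (cartesianProduct⁺ (allFin⁺ n) (allFin⁺ n))

  -- The vertex itself is excluded because the colouring is arbitrary on the diagonal.
  neighbours : Fin 3 → V → List V
  neighbours a v = filter (λ u → ¬? (u ≟ v) ×-dec (col v u ≟ a)) (allFin n)

  neighbours! : ∀ a v → Unique (neighbours a v)
  neighbours! a v = filter⁺ _ (allFin⁺ n)

  ∈-neighbours⁻ : ∀ a v {u} → u ∈ neighbours a v → u ≢ v × col v u ≡ a
  ∈-neighbours⁻ a v u∈ = proj₂ (∈-filter⁻ (λ u → ¬? (u ≟ v) ×-dec (col v u ≟ a)) {xs = allFin n} u∈)

  degree : Fin 3 → V → ℕ
  degree a v = length (neighbours a v)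

  Off : List V → V × V → Set
  Off F (x , y) = x ∉ F × y ∉ F

  off? : ∀ F → Decidable (Off F)
  off? F (x , y) = (x ∉? F) ×-dec (y ∉? F)

  edgesOff : Fin 3 → List V → List (V × V)
  edgesOff a F = filter (off? F) (edges a)

  edgesOff! : ∀ a F → Unique (edgesOff a F)
  edgesOff! a F = filter⁺ (off? F) (edges! a)

  ∈-edges⁻ : ∀ a {x y} → (x , y) ∈ edges a → x Fin.< y × col x y ≡ a
  ∈-edges⁻ a e∈ = proj₂ (∈-filter⁻ _ {xs = cartesianProduct (allFin n) (allFin n)} e∈)

  ∈-edgesOff⁻ : ∀ a F {e} → e ∈ edgesOff a F → e ∈ edges a × Off F e
  ∈-edgesOff⁻ a F = ∈-filter⁻ (off? F) {xs = edges a}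

  Touches : V → V × V → Set
  Touches v (x , y) = x ≡ v ⊎ y ≡ v

  touches? : ∀ v → Decidable (Touches v)
  touches? v (x , y) = (x ≟ v) ⊎-dec (y ≟ v)

  -- For an edge that does not touch `v` the value is the first endpoint and has no meaning.
  otherEnd : V → V × V → V
  otherEnd v (x , y) with x ≟ v
  ... | yes _ = y
  ... | no  _ = x

  otherEnd∈neighbours : ∀ {a v e} → e ∈ edges a → Touches v e → otherEnd v e ∈ neighbours a v
  otherEnd∈neighbours {a} {v} {x , y} e∈ t with x<y , eq ← ∈-edges⁻ a e∈ | x ≟ v
  ... | yes refl = ∈-filter⁺ _ (∈-allFin y) (<⇒≢ x<y ∘ sym , eq)
  ... | no x≢v with t
  ...   | inj₁ x≡v  = contradiction x≡v x≢v
  ...   | inj₂ refl = ∈-filter⁺ _ (∈-allFin x) (x≢v , trans (col-sym _ _) eq)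

  -- Edges are stored with the smaller endpoint first. Hence `v` cannot be the first end of one edge
  -- and the second end of the other while the remaining ends agree.
  otherEnd-injective : ∀ {a v e e′} → e ∈ edges a → e′ ∈ edges a → Touches v e → Touches v e′ →
                       otherEnd v e ≡ otherEnd v e′ → e ≡ e′
  otherEnd-injective {a} {v} {x , y} {x′ , y′} e∈ e′∈ t t′ eq
    with x<y , _ ← ∈-edges⁻ a e∈ | x′<y′ , _ ← ∈-edges⁻ a e′∈ | x ≟ v | x′ ≟ v
  ... | yes refl | yes refl = cong (x ,_) eq
  otherEnd-injective _ _ t (inj₁ p) eq | yes refl | no ¬p = contradiction p ¬p
  otherEnd-injective _ _ t (inj₂ refl) refl | yes refl | no _ = contradiction x′<y′ (<-asym x<y)
  otherEnd-injective _ _ (inj₁ p) t′ eq | no ¬p | yes refl = contradiction p ¬p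
  otherEnd-injective _ _ (inj₂ refl) t′ refl | no _ | yes refl = contradiction x′<y′ (<-asym x<y)
  otherEnd-injective _ _ (inj₁ p) t′ eq | no ¬p | no _ = contradiction p ¬p
  otherEnd-injective _ _ t (inj₁ p) eq | no _ | no ¬p = contradiction p ¬p
  otherEnd-injective _ _ (inj₂ refl) (inj₂ refl) refl | no _ | no _ = refl

  -- The edges lost by also deleting `v` all touch `v`, and `otherEnd` embeds them into its
  -- neighbours.
  edgesOff-∷ : ∀ a v F → length (edgesOff a F) ≤ length (edgesOff a (v ∷ F)) + degree a v
  edgesOff-∷ a v F = begin
    length (edgesOff a F)
      ≤⟨ length≤filter+filter (¬? ∘ touches? v) (touches? v) (λ e → swap (toSum (touches? v e))) (edgesOff a F) ⟩
    length (filter (¬? ∘ touches? v) (edgesOff a F)) + length (filter (touches? v) (edgesOff a F))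
      ≤⟨ +-mono-≤ (unique-⊆⇒length≤ (filter⁺ _ (edgesOff! a F)) away)
                  (injectiveOn⇒length≤ (otherEnd v) (filter⁺ (touches? v) (edgesOff! a F))
                     (λ e∈ → let e∈a , t = touching e∈ in otherEnd∈neighbours e∈a t)
                     (λ e∈ e′∈ → let e∈a , t = touching e∈; e′∈a , t′ = touching e′∈ in
                                 otherEnd-injective e∈a e′∈a t t′)) ⟩
    length (edgesOff a (v ∷ F)) + degree a v ∎
    where
    open ≤-Reasoning
    touching : ∀ {e} → e ∈ filter (touches? v) (edgesOff a F) → e ∈ edges a × Touches v e
    touching e∈ with e∈off , t ← ∈-filter⁻ (touches? v) {xs = edgesOff a F} e∈ =
      proj₁ (∈-edgesOff⁻ a F e∈off) , t
    away : ∀ {e} → e ∈ filter (¬? ∘ touches? v) (edgesOff a F) → e ∈ edgesOff a (v ∷ F)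
    away e∈ with e∈off , ¬t ← ∈-filter⁻ (¬? ∘ touches? v) {xs = edgesOff a F} e∈
      with e∈a , x∉F , y∉F ← ∈-edgesOff⁻ a F e∈off =
      ∈-filter⁺ (off? (v ∷ F)) e∈a
        ( (λ { (here x≡v) → ¬t (inj₁ x≡v) ; (there x∈F) → x∉F x∈F })
        , (λ { (here y≡v) → ¬t (inj₂ y≡v) ; (there y∈F) → y∉F y∈F }))

  edgesOff-∈ : ∀ a {v F} → v ∈ F → length (edgesOff a F) ≤ length (edgesOff a (v ∷ F))
  edgesOff-∈ a {v} {F} v∈F = unique-⊆⇒length≤ (edgesOff! a F) λ e∈ →
    let e∈a , x∉F , y∉F = ∈-edgesOff⁻ a F e∈ in
    ∈-filter⁺ (off? (v ∷ F)) e∈a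
      ((λ { (here refl) → x∉F v∈F ; (there x∈F) → x∉F x∈F })
      , (λ { (here refl) → y∉F v∈F ; (there y∈F) → y∉F y∈F }))

  LowOff : ℕ → Fin 3 → List V → Set
  LowOff D a A = ∀ v → v ∉ A → degree a v ≤ D

  -- Vertices of `F` are deleted one at a time. One that lies in `A` is already gone and costs
  -- nothing; any other costs at most its degree, hence at most `D`.
  edgesOff-++ : ∀ {D a A} → LowOff D a A → ∀ F →
                length (edgesOff a A) ≤ length (edgesOff a (F ++ A)) + length F * D
  edgesOff-++ {D} {a} {A} low [] = m≤m+n _ _
  edgesOff-++ {D} {a} {A} low (f ∷ F) = begin
    length (edgesOff a A)                                    ≤⟨ edgesOff-++ low F ⟩
    length (edgesOff a (F ++ A)) + length F * D              ≤⟨ +-monoˡ-≤ (length F * D) step ⟩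
    length (edgesOff a (f ∷ F ++ A)) + D + length F * D
      ≡⟨ +-assoc (length (edgesOff a (f ∷ F ++ A))) D (length F * D) ⟩
    length (edgesOff a (f ∷ F ++ A)) + (D + length F * D)    ∎
    where
    open ≤-Reasoning
    step : length (edgesOff a (F ++ A)) ≤ length (edgesOff a (f ∷ F ++ A)) + D
    step with f ∈? A
    ... | yes f∈A = ≤-trans (edgesOff-∈ a (∈-++⁺ʳ F f∈A)) (m≤m+n _ D)
    ... | no  f∉A = ≤-trans (edgesOff-∷ a f (F ++ A)) (+-monoʳ-≤ _ (low f f∉A))

  colourCount≤edgesOff[] : ∀ a → colourCount colouring a ≤ length (edgesOff a [])
  colourCount≤edgesOff[] a =
    unique-⊆⇒length≤ (edges! a) (λ e∈ → ∈-filter⁺ (off? []) e∈ ((λ ()) , (λ ())))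

  degree+degree≤n : ∀ {a b} → a ≢ b → ∀ v → degree a v + degree b v ≤ n
  degree+degree≤n {a} {b} a≢b v = begin
    degree a v + degree b v                   ≡⟨ length-++ (neighbours a v) ⟨
    length (neighbours a v ++ neighbours b v) ≤⟨ unique⇒length≤ (++⁺ (neighbours! a v) (neighbours! b v)
                                                   λ (∈a , ∈b) → a≢b (trans (sym (proj₂ (∈-neighbours⁻ a v ∈a)))
                                                                             (proj₂ (∈-neighbours⁻ b v ∈b)))) ⟩
    n ∎
    where open ≤-Reasoning

  leaf : ∀ a v F → length F < degree a v → ∃[ u ] (col u v ≡ a × u ∉ F)
  leaf a v F F<deg with All.all? (_∈? F) (neighbours a v)
  ... | yes all∈ = contradiction (unique-⊆⇒length≤ (neighbours! a v) (All.lookup all∈)) (<⇒≱ F<deg)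
  ... | no ¬all∈ with u , u∈ , u∉F ← find (¬All⇒Any¬ (_∈? F) _ ¬all∈) =
    u , trans (col-sym _ _) (proj₂ (∈-neighbours⁻ a v u∈)) , u∉F

  record Edge (a : Fin 3) (F : List V) : Set where
    constructor edge
    field
      x y : V
      coloured : col x y ≡ a
      distinct : Unique (x ∷ y ∷ [])
      avoids   : (x ∷ y ∷ []) # F

  record Cherry (a : Fin 3) (F : List V) : Set where
    constructor cherry
    field
      x y z : V
      xy : col x y ≡ a
      yz : col y z ≡ a
      distinct : Unique (x ∷ y ∷ z ∷ [])
      avoids   : (x ∷ y ∷ z ∷ []) # F

  findEdge : ∀ a F → 0 < length (edgesOff a F) → Edge a F
  findEdge a F 0< with edgesOff a F in eq
  ... | (x , y) ∷ _ with e∈a , x∉F , y∉F ← ∈-edgesOff⁻ a F {x , y} (subst ((x , y) ∈_) (sym eq) (here refl))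
                    with x<y , col≡a ← ∈-edges⁻ a e∈a =
    edge x y col≡a ((<⇒≢ x<y ∷ []) ∷ [] ∷ []) (x∉F ∷ y∉F ∷ [])

  -- That this list is free of duplicates is how `es` is said to be a matching.
  endpoints : List (V × V) → List V
  endpoints = concatMap λ (x , y) → x ∷ y ∷ []

  length-endpoints : ∀ es → length (endpoints es) ≡ length es + length es
  length-endpoints []       = refl
  length-endpoints (e ∷ es) = cong suc (trans (cong suc (length-endpoints es)) (sym (+-suc _ _)))

  ∈-endpoints⁻ : ∀ {v} es → v ∈ endpoints es → ∃[ e ] (e ∈ es × Touches v e)
  ∈-endpoints⁻ (e ∷ es) (here refl)         = e , here refl , inj₁ refl
  ∈-endpoints⁻ (e ∷ es) (there (here refl)) = e , here refl , inj₂ refl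
  ∈-endpoints⁻ (e ∷ es) (there (there v∈)) with e′ , e′∈ , t ← ∈-endpoints⁻ es v∈ = e′ , there e′∈ , t

  otherEnd-avoids : ∀ {F} v e → Off F e → otherEnd v e ∉ F
  otherEnd-avoids v (x , y) (x∉F , y∉F) with x ≟ v
  ... | yes _ = y∉F
  ... | no  _ = x∉F

  meetingEdges : ∀ {a F v e e′} → e ∈ edgesOff a F → e′ ∈ edgesOff a F → e ≢ e′ →
                 Touches v e → Touches v e′ → Cherry a F
  meetingEdges {a} {F} {v} {e} {e′} e∈ e′∈ e≢e′ t t′
    with e∈a , off ← ∈-edgesOff⁻ a F e∈ | e′∈a , off′ ← ∈-edgesOff⁻ a F e′∈
    with u≢v , vu ← ∈-neighbours⁻ a v (otherEnd∈neighbours e∈a t)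
       | w≢v , vw ← ∈-neighbours⁻ a v (otherEnd∈neighbours e′∈a t′) =
    cherry (otherEnd v e) v (otherEnd v e′) (trans (col-sym _ _) vu) vw
      ((u≢v ∷ (e≢e′ ∘ otherEnd-injective e∈a e′∈a t t′) ∷ []) ∷ ((w≢v ∘ sym) ∷ []) ∷ [] ∷ [])
      (otherEnd-avoids v e off ∷ v∉F t off ∷ otherEnd-avoids v e′ off′ ∷ [])
    where
    v∉F : Touches v e → Off F e → v ∉ F
    v∉F (inj₁ refl) (x∉F , _) = x∉F
    v∉F (inj₂ refl) (_ , y∉F) = y∉F

  -- A new edge either has an end among the earlier endpoints, so that two distinct edges meet and
  -- form a cherry, or it extends the matching.
  cherryOrMatching : ∀ a F es → Unique es → All (_∈ edgesOff a F) es →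
                     Cherry a F ⊎ Unique (endpoints es)
  cherryOrMatching a F [] _ _ = inj₂ []
  cherryOrMatching a F (e@(x , y) ∷ es) (e≢ ∷ es!) (e∈ ∷ es∈)
    with cherryOrMatching a F es es! es∈
  ... | inj₁ found = inj₁ found
  ... | inj₂ ends! with x ∈? endpoints es | y ∈? endpoints es
  ...   | yes x∈ | _ with e′ , e′∈ , t ← ∈-endpoints⁻ es x∈ =
    inj₁ (meetingEdges e∈ (All.lookup es∈ e′∈) (All.lookup e≢ e′∈) (inj₁ refl) t)
  ...   | no _ | yes y∈ with e′ , e′∈ , t ← ∈-endpoints⁻ es y∈ =
    inj₁ (meetingEdges e∈ (All.lookup es∈ e′∈) (All.lookup e≢ e′∈) (inj₂ refl) t)
  ...   | no x∉ | no y∉ =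
    inj₂ ((<⇒≢ (proj₁ (∈-edges⁻ a (proj₁ (∈-edgesOff⁻ a F e∈)))) ∷ ¬Any⇒All¬ _ x∉) ∷ ¬Any⇒All¬ _ y∉ ∷ ends!)

  -- The endpoints of a matching are distinct vertices, so more than n/2 edges cannot form one.
  findCherry : ∀ a F → n < length (edgesOff a F) + length (edgesOff a F) → Cherry a F
  findCherry a F n< with cherryOrMatching a F (edgesOff a F) (edgesOff! a F) (All.tabulate id)
  ... | inj₁ found = found
  ... | inj₂ ends! = contradiction
    (subst (_≤ n) (length-endpoints (edgesOff a F)) (unique⇒length≤ ends!)) (<⇒≱ n<)

-- The upper bound

-- D is the degree from which on a vertex counts as a centre, so D must exceed the size of every
-- list of vertices to be avoided (at most 14). Of more than K edges,
-- one survives the deletion of any 12 vertices of degree at most D. S is the excess over n/2,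
-- which has to exceed K + D.
D K S : ℕ
D = 20
K = 12 * D
S = 14 * D

-- Everything is doubled to avoid fractions: a class of at least n/2 + S edges that loses `t` of
-- them, with `t` below `S`, keeps more than n/2.
excess-bound : ∀ {n c o t} → n + (S + S) ≤ c + c → c ≤ o + t → t < S → n < o + o
excess-bound {n} {c} {o} {t} n+2S≤2c c≤o+t t<S = +-cancelʳ-≤ (t + t) (suc n) (o + o) (begin
  suc n + (t + t)       ≡⟨ +-suc n (t + t) ⟨
  n + suc (t + t)       ≤⟨ +-monoʳ-≤ n (+-mono-≤ t<S (<⇒≤ t<S)) ⟩
  n + (S + S)           ≤⟨ n+2S≤2c ⟩
  c + c                 ≤⟨ +-mono-≤ c≤o+t c≤o+t ⟩
  (o + t) + (o + t)     ≡⟨ interchange +-commutativeSemigroup o t o t ⟩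
  (o + o) + (t + t)     ∎)
  where open ≤-Reasoning

module _ {n : ℕ} (colouring : Colouring n)
         (large : ∀ a → n + (S + S) ≤ colourCount colouring a + colourCount colouring a) where

  open Graph colouring
  open Certificates
  open DecMembership {A = Fin n} _≟_ using (_∉?_)

  private
    V = Fin n
    Goal = HasBalancedP6 colouring
    variable
      a b c : Fin 3
      A B C : List V
      u v w : V

  Star : Fin 3 → V → Set
  Star a v = D < degree a v

  -- This unites the two ways to obtain cherries. `A` holds the centre to be used, or is empty when
  -- the colour has no centre; in either case only `A` has to be kept out of the avoided list `F`.
  record Source (a : Fin 3) (A : List V) : Set where
    field
      small    : length A ≤ 1
      cherryAt : ∀ F → length F ≤ 12 → A # F → Cherry a F

  -- Without centres, deleting 12 vertices costs at most `K` edges, which is less than `S`, so more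
  -- than n/2 remain and `findCherry` applies.
  low⇒source : LowOff D a [] → Source a []
  low⇒source {a} low = record { small = z≤n ; cherryAt = λ F F≤12 _ → weaken F (findCherry a (F ++ [])
      (excess-bound {n} {colourCount colouring a} {length (edgesOff a (F ++ []))} {length F * D} (large a)
        (≤-trans (colourCount≤edgesOff[] a) (edgesOff-++ low F))
        (≤-trans (s≤s (*-monoˡ-≤ D F≤12)) (≤ᵇ⇒≤ (suc K) S tt)))) }
    where
    weaken : ∀ F → Cherry a (F ++ []) → Cherry a F
    weaken F (cherry x y z xy yz dist avoids) = cherry x y z xy yz dist (#-++ˡ avoids)

  leafOf : Star a v → ∀ F → length F ≤ D → ∃[ u ] (proj₁ colouring u v ≡ a × u ∉ F)
  leafOf {a} {v} star F F≤D = leaf a v F (≤-trans (s≤s F≤D) star)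

  star⇒source : Star a v → Source a (v ∷ [])
  star⇒source {a} {v} star = record { small = ≤-refl ; cherryAt = at }
    where
    at : ∀ F → length F ≤ 12 → (v ∷ []) # F → Cherry a F
    at F F≤12 (v∉F ∷ [])
      -- The leaves are chosen in turn: the first avoids `F` and the centre, the second also the
      -- first leaf, hence the bounds 13 and 14.
      with u , uv , u∉ ← leafOf star (v ∷ F) (≤-trans (s≤s F≤12) (≤ᵇ⇒≤ 13 D tt))
      with w , wv , w∉ ← leafOf star (u ∷ v ∷ F) (≤-trans (s≤s (s≤s F≤12)) (≤ᵇ⇒≤ 14 D tt)) =
      cherry u v w uv (trans (proj₂ colouring v w) wv)
        (((u∉ ∘ here) ∷ (w∉ ∘ here ∘ sym) ∷ []) ∷ ((w∉ ∘ there ∘ here ∘ sym) ∷ []) ∷ [] ∷ [])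
        ((u∉ ∘ there) ∷ v∉F ∷ (w∉ ∘ there ∘ there) ∷ [])

  source : ∀ a → Source a [] ⊎ ∃[ v ] Star a v
  source a with any? (λ v → D <? degree a v)
  ... | yes star  = inj₂ star
  ... | no ¬star = inj₁ (low⇒source λ v _ → ≮⇒≥ (λ star → ¬star (v , star)))

  -- From centres to certified configurations

  open Source

  -- Cherries are chosen greedily in the order `c`, `b`, `a`. Each one also avoids the centres of
  -- the colours still to come, so that these stay available.
  threeSources : Rainbow a b c → Source a A → Source b B → Source c C →
                 A # B → A # C → B # C → Goal
  threeSources {A = A} {B} {C} abc sa sb sc A#B A#C B#C
    with cherry z₁ z₂ z₃ z₁₂ z₂₃ zs! zs#
         ← cherryAt sc (A ++ B)
                    (≤-trans (≤-reflexive (length-++ A))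
                             (≤-trans (+-mono-≤ (small sa) (small sb)) (≤ᵇ⇒≤ 2 12 tt)))
                    (#-++ (#-sym A#C) (#-sym B#C))
    with cherry y₁ y₂ y₃ y₁₂ y₂₃ ys! ys#
         ← cherryAt sb (z₁ ∷ z₂ ∷ z₃ ∷ A) (≤-trans (+-monoʳ-≤ 3 (small sa)) (≤ᵇ⇒≤ 4 12 tt))
                    (#-++ (#-sym (#-++ʳ A zs#)) (#-sym A#B))
    with cherry x₁ x₂ x₃ x₁₂ x₂₃ xs! xs#
         ← cherryAt sa (y₁ ∷ y₂ ∷ y₃ ∷ z₁ ∷ z₂ ∷ z₃ ∷ []) (≤ᵇ⇒≤ 6 12 tt)
                    (#-++ (#-sym (#-++ʳ (z₁ ∷ z₂ ∷ z₃ ∷ []) ys#)) (#-sym (#-++ˡ zs#)))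
    = certificate-sound colouring abc (unique-++ xs! (unique-++ ys! zs! (#-++ˡ ys#)) xs#) threeCherriesCertificate
        (x₁₂ ∷ x₂₃ ∷ y₁₂ ∷ y₂₃ ∷ z₁₂ ∷ z₂₃ ∷ [])

  edgeAvoiding : LowOff D a A → K < length (edgesOff a A) → ∀ F → length F ≤ 12 → Edge a F
  edgeAvoiding {a} {A} low many F F≤12 = weaken (findEdge a (F ++ A)
      (+-cancelʳ-≤ (length F * D) 1 _ (begin-strict
        length F * D                                     ≤⟨ *-monoˡ-≤ D F≤12 ⟩
        K                                                <⟨ many ⟩
        length (edgesOff a A)                            ≤⟨ edgesOff-++ low F ⟩
        length (edgesOff a (F ++ A)) + length F * D      ∎)))
    where
    open ≤-Reasoning
    weaken : Edge a (F ++ A) → Edge a F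
    weaken (edge x y xy xy! avoids) = edge x y xy xy! (#-++ˡ avoids)

  -- If `a` has a centre outside `B` and `C`, it is a third source with a separate centre. Otherwise
  -- all degrees in `a` are low there, and two disjoint edges of `a` survive the deletion of the two
  -- cherries.
  twoSources : Rainbow a b c → Source b B → Source c C → B # C →
               K < length (edgesOff a (B ++ C)) → Goal
  twoSources {a} {b} {c} {B} {C} abc sb sc B#C many
    with any? (λ w → (w ∉? (B ++ C)) ×-dec (D <? degree a w))
  ... | yes (w , w∉ , star) =
    threeSources abc (star⇒source star) sb sc
      (#-++ˡ (w∉ ∷ [])) (#-++ʳ B (w∉ ∷ [])) B#C
  ... | no ¬star
    with cherry z₁ z₂ z₃ z₁₂ z₂₃ zs! zs#
         ← cherryAt sc B (≤-trans (small sb) (≤ᵇ⇒≤ 1 12 tt)) (#-sym B#C)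
    with cherry y₁ y₂ y₃ y₁₂ y₂₃ ys! ys#
         ← cherryAt sb (z₁ ∷ z₂ ∷ z₃ ∷ []) (≤ᵇ⇒≤ 3 12 tt) (#-sym zs#)
    with low ← (λ w w∉ → ≮⇒≥ (λ star → ¬star (w , w∉ , star)))
    with edge x₁ x₂ x₁₂ xs! xs# ← edgeAvoiding low many (y₁ ∷ y₂ ∷ y₃ ∷ z₁ ∷ z₂ ∷ z₃ ∷ []) (≤ᵇ⇒≤ 6 12 tt)
    with edge t₁ t₂ t₁₂ ts! ts# ← edgeAvoiding low many (x₁ ∷ x₂ ∷ y₁ ∷ y₂ ∷ y₃ ∷ z₁ ∷ z₂ ∷ z₃ ∷ []) (≤ᵇ⇒≤ 8 12 tt)
    = certificate-sound colouring abc
        (unique-++ ts! (unique-++ xs! (unique-++ ys! zs! ys#) xs#) ts#) twoCherriesTwoEdgesCertificate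
        (t₁₂ ∷ x₁₂ ∷ y₁₂ ∷ y₂₃ ∷ z₁₂ ∷ z₂₃ ∷ [])

  -- Eight leaves are chosen greedily. Both centres are avoided throughout, so that neither serves
  -- as a leaf of the other.
  twoStars : Rainbow a b c → v ≢ w → Star a v → Star b v → Star a w → Star c w → Goal
  twoStars {v = v} {w} abc v≢w av bv aw cw
    with l₁ , e₁ , ∉₁ ← leafOf av (v ∷ w ∷ []) (≤ᵇ⇒≤ 2 D tt)
    with l₂ , e₂ , ∉₂ ← leafOf av (l₁ ∷ v ∷ w ∷ []) (≤ᵇ⇒≤ 3 D tt)
    with l₃ , e₃ , ∉₃ ← leafOf bv (l₂ ∷ l₁ ∷ v ∷ w ∷ []) (≤ᵇ⇒≤ 4 D tt)
    with l₄ , e₄ , ∉₄ ← leafOf bv (l₃ ∷ l₂ ∷ l₁ ∷ v ∷ w ∷ []) (≤ᵇ⇒≤ 5 D tt)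
    with l₅ , e₅ , ∉₅ ← leafOf cw (l₄ ∷ l₃ ∷ l₂ ∷ l₁ ∷ v ∷ w ∷ []) (≤ᵇ⇒≤ 6 D tt)
    with l₆ , e₆ , ∉₆ ← leafOf cw (l₅ ∷ l₄ ∷ l₃ ∷ l₂ ∷ l₁ ∷ v ∷ w ∷ []) (≤ᵇ⇒≤ 7 D tt)
    with l₇ , e₇ , ∉₇ ← leafOf aw (l₆ ∷ l₅ ∷ l₄ ∷ l₃ ∷ l₂ ∷ l₁ ∷ v ∷ w ∷ []) (≤ᵇ⇒≤ 8 D tt)
    with l₈ , e₈ , ∉₈ ← leafOf aw (l₇ ∷ l₆ ∷ l₅ ∷ l₄ ∷ l₃ ∷ l₂ ∷ l₁ ∷ v ∷ w ∷ []) (≤ᵇ⇒≤ 9 D tt)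
    = certificate-sound colouring abc
        (¬Any⇒All¬ _ ∉₈ ∷ ¬Any⇒All¬ _ ∉₇ ∷ ¬Any⇒All¬ _ ∉₆ ∷ ¬Any⇒All¬ _ ∉₅ ∷ ¬Any⇒All¬ _ ∉₄ ∷
         ¬Any⇒All¬ _ ∉₃ ∷ ¬Any⇒All¬ _ ∉₂ ∷ ¬Any⇒All¬ _ ∉₁ ∷ (v≢w ∷ []) ∷ [] ∷ [])
        twoStarsCertificate
        (e₈ ∷ e₇ ∷ e₆ ∷ e₅ ∷ e₄ ∷ e₃ ∷ e₂ ∷ e₁ ∷ [])

  -- Colour `c` appears only at the star, so it receives two leaves there and the others one each.
  -- The matching edges come last and avoid at most 11 vertices.
  starTwoMatchings : Rainbow a b c → Star a v → Star b v → Star c v →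
                     LowOff D a A → K < length (edgesOff a A) →
                     LowOff D b B → K < length (edgesOff b B) → Goal
  starTwoMatchings {v = v} abc av bv cv aLow aMany bLow bMany
    with l₁ , e₁ , ∉₁ ← leafOf cv (v ∷ []) (≤ᵇ⇒≤ 1 D tt)
    with l₂ , e₂ , ∉₂ ← leafOf cv (l₁ ∷ v ∷ []) (≤ᵇ⇒≤ 2 D tt)
    with l₃ , e₃ , ∉₃ ← leafOf bv (l₂ ∷ l₁ ∷ v ∷ []) (≤ᵇ⇒≤ 3 D tt)
    with l₄ , e₄ , ∉₄ ← leafOf av (l₃ ∷ l₂ ∷ l₁ ∷ v ∷ []) (≤ᵇ⇒≤ 4 D tt)
    with edge p₁ p₂ p₁₂ ps! ps# ← edgeAvoiding bLow bMany (l₄ ∷ l₃ ∷ l₂ ∷ l₁ ∷ v ∷ []) (≤ᵇ⇒≤ 5 12 tt)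
    with edge q₁ q₂ q₁₂ qs! qs# ← edgeAvoiding bLow bMany (p₁ ∷ p₂ ∷ l₄ ∷ l₃ ∷ l₂ ∷ l₁ ∷ v ∷ []) (≤ᵇ⇒≤ 7 12 tt)
    with edge r₁ r₂ r₁₂ rs! rs# ← edgeAvoiding aLow aMany
           (q₁ ∷ q₂ ∷ p₁ ∷ p₂ ∷ l₄ ∷ l₃ ∷ l₂ ∷ l₁ ∷ v ∷ []) (≤ᵇ⇒≤ 9 12 tt)
    with edge s₁ s₂ s₁₂ ss! ss# ← edgeAvoiding aLow aMany
           (r₁ ∷ r₂ ∷ q₁ ∷ q₂ ∷ p₁ ∷ p₂ ∷ l₄ ∷ l₃ ∷ l₂ ∷ l₁ ∷ v ∷ []) (≤ᵇ⇒≤ 11 12 tt)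
    = certificate-sound colouring abc
        (unique-++ ss! (unique-++ rs! (unique-++ qs! (unique-++ ps!
          (¬Any⇒All¬ _ ∉₄ ∷ ¬Any⇒All¬ _ ∉₃ ∷ ¬Any⇒All¬ _ ∉₂ ∷ ¬Any⇒All¬ _ ∉₁ ∷ [] ∷ [])
          ps#) qs#) rs#) ss#)
        starTwoMatchingsCertificate
        (s₁₂ ∷ r₁₂ ∷ q₁₂ ∷ p₁₂ ∷ e₄ ∷ e₃ ∷ e₂ ∷ e₁ ∷ [])

  -- Each of the two degrees at `v` would exceed n/2, while together they are at most n.
  notBothConcentrated : ∀ {t} → a ≢ b → ∀ v → t < S →
    colourCount colouring a ≤ degree a v + t → colourCount colouring b ≤ degree b v + t → ⊥
  notBothConcentrated {a} {b} a≢b v t<S a≤ b≤ = <⇒≱ (begin-strict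
      n + n
        <⟨ +-mono-< (excess-bound (large a) a≤ t<S) (excess-bound (large b) b≤ t<S) ⟩
      (degree a v + degree a v) + (degree b v + degree b v)
        ≡⟨ interchange +-commutativeSemigroup (degree a v) (degree a v) (degree b v) (degree b v) ⟩
      (degree a v + degree b v) + (degree a v + degree b v)   ∎)
    (+-mono-≤ (degree+degree≤n a≢b v) (degree+degree≤n a≢b v))
    where
    open ≤-Reasoning

  colourCount≤ : ∀ a v → colourCount colouring a ≤ degree a v + length (edgesOff a (v ∷ []))
  colourCount≤ a v = begin
    colourCount colouring a                        ≤⟨ colourCount≤edgesOff[] a ⟩
    length (edgesOff a [])                         ≤⟨ edgesOff-∷ a v [] ⟩
    length (edgesOff a (v ∷ [])) + degree a v      ≡⟨ +-comm _ (degree a v) ⟩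
    degree a v + length (edgesOff a (v ∷ []))      ∎
    where open ≤-Reasoning

  -- Otherwise both colours have all but `K` of their edges at `v`.
  manyOff : a ≢ b → ∀ v → K < length (edgesOff a (v ∷ [])) ⊎ K < length (edgesOff b (v ∷ []))
  manyOff {a} {b} a≢b v with K <? length (edgesOff a (v ∷ [])) | K <? length (edgesOff b (v ∷ []))
  ... | yes aMany | _ = inj₁ aMany
  ... | no  _ | yes bMany = inj₂ bMany
  ... | no aFew | no bFew = contradiction (bound bFew) (notBothConcentrated a≢b v (≤ᵇ⇒≤ (suc K) S tt) (bound aFew))
    where
    bound : ∀ {a} → ¬ K < length (edgesOff a (v ∷ [])) → colourCount colouring a ≤ degree a v + K
    bound {a} few = ≤-trans (colourCount≤ a v) (+-monoʳ-≤ (degree a v) (≮⇒≥ few))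

  -- Case analysis on coinciding centres

  swap₁₂ : Rainbow a b c → Rainbow b a c
  swap₁₂ ((ab ∷ ac ∷ []) ∷ (bc ∷ []) ∷ [] ∷ []) = ((ab ∘ sym) ∷ bc ∷ []) ∷ (ac ∷ []) ∷ [] ∷ []

  swap₂₃ : Rainbow a b c → Rainbow a c b
  swap₂₃ ((ab ∷ ac ∷ []) ∷ (bc ∷ []) ∷ [] ∷ []) = (ac ∷ ab ∷ []) ∷ ((bc ∘ sym) ∷ []) ∷ [] ∷ []

  rainbow⇒≢ : Rainbow a b c → a ≢ b
  rainbow⇒≢ ((ab ∷ _) ∷ _) = ab

  ≢⇒# : v ≢ w → (v ∷ []) # (w ∷ [])
  ≢⇒# v≢w = (λ { (here eq) → v≢w eq }) ∷ []

  -- Cherries of `c` need no centre, so the only conflict is a centre shared by `a` and `b`. One of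
  -- these two then has many edges away from it and supplies loose edges, leaving the centre to the
  -- other.
  oneLow : Rainbow a b c → Source c [] → Goal
  oneLow {a} {b} abc sc with source a | source b
  ... | inj₁ sa       | inj₁ sb       = threeSources abc sa sb sc [] [] []
  ... | inj₁ sa       | inj₂ (w , bw) = threeSources abc sa (star⇒source bw) sc [] [] ((λ ()) ∷ [])
  ... | inj₂ (v , av) | inj₁ sb       = threeSources abc (star⇒source av) sb sc ((λ ()) ∷ []) ((λ ()) ∷ []) []
  ... | inj₂ (v , av) | inj₂ (w , bw) with v ≟ w
  ...   | no v≢w = threeSources abc (star⇒source av) (star⇒source bw) sc (≢⇒# v≢w) ((λ ()) ∷ []) ((λ ()) ∷ [])
  ...   | yes refl with manyOff (rainbow⇒≢ abc) v
  ...     | inj₁ aMany = twoSources abc (star⇒source bw) sc ((λ ()) ∷ []) aMany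
  ...     | inj₂ bMany = twoSources (swap₁₂ abc) (star⇒source av) sc ((λ ()) ∷ []) bMany

  -- If `a` or `b` has many edges off both centres, it supplies loose edges. If not, and `w` is a
  -- centre of `a` or `b` too, two stars arise. Otherwise both colours have all but K + D of their
  -- edges at `v`, which is impossible.
  sharedCentre : Rainbow a b c → v ≢ w → Star a v → Star b v → Star c w → Goal
  sharedCentre {a} {b} {c} {v} {w} abc v≢w av bv cw
    with K <? length (edgesOff a (v ∷ w ∷ [])) | K <? length (edgesOff b (v ∷ w ∷ []))
  ... | yes aMany | _ = twoSources abc (star⇒source bv) (star⇒source cw) (≢⇒# v≢w) aMany
  ... | no _ | yes bMany = twoSources (swap₁₂ abc) (star⇒source av) (star⇒source cw) (≢⇒# v≢w) bMany
  ... | no aFew | no bFew with D <? degree a w | D <? degree b w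
  ...   | yes aw | _ = twoStars abc v≢w av bv aw cw
  ...   | no _ | yes bw = twoStars (swap₁₂ abc) v≢w bv av bw cw
  ...   | no ¬aw | no ¬bw = contradiction (bound bFew ¬bw)
                              (notBothConcentrated (rainbow⇒≢ abc) v (≤ᵇ⇒≤ (suc (K + D)) S tt) (bound aFew ¬aw))
    where
    open ≤-Reasoning
    bound : ∀ {a} → ¬ K < length (edgesOff a (v ∷ w ∷ [])) → ¬ D < degree a w →
            colourCount colouring a ≤ degree a v + (K + D)
    bound {a} few ¬aw = begin
      colourCount colouring a                                        ≤⟨ colourCount≤edgesOff[] a ⟩
      length (edgesOff a [])                                         ≤⟨ edgesOff-∷ a w [] ⟩
      length (edgesOff a (w ∷ [])) + degree a w                      ≤⟨ +-mono-≤ (edgesOff-∷ a v (w ∷ [])) (≮⇒≥ ¬aw) ⟩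
      length (edgesOff a (v ∷ w ∷ [])) + degree a v + D              ≤⟨ +-monoˡ-≤ D (+-monoˡ-≤ (degree a v) (≮⇒≥ few)) ⟩
      K + degree a v + D                                             ≡⟨ cong (_+ D) (+-comm K (degree a v)) ⟩
      degree a v + K + D                                             ≡⟨ +-assoc (degree a v) K D ⟩
      degree a v + (K + D)                                           ∎

  -- The centre `u` may coincide with one of the others; the colours are then permuted so that the
  -- coinciding pair comes first.
  distinctCentres : Rainbow a b c → v ≢ w → Star a v → Star b w → Star c u → Goal
  distinctCentres {v = v} {w} {u} abc v≢w av bw cu with u ≟ v | u ≟ w
  ... | yes refl | _ = sharedCentre (swap₂₃ abc) v≢w av cu bw
  ... | no _ | yes refl = sharedCentre (swap₁₂ (swap₂₃ (swap₁₂ abc))) (v≢w ∘ sym) cu bw av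
  ... | no u≢v | no u≢w =
    threeSources abc (star⇒source av) (star⇒source bw) (star⇒source cu)
      (≢⇒# v≢w) (≢⇒# (u≢v ∘ sym)) (≢⇒# (u≢w ∘ sym))

  otherCentre? : ∀ a v → (∃[ w ] (w ≢ v × Star a w)) ⊎ LowOff D a (v ∷ [])
  otherCentre? a v with any? (λ w → ¬? (w ≟ v) ×-dec (D <? degree a w))
  ... | yes found = inj₁ found
  ... | no ¬found = inj₂ λ w w∉ → ≮⇒≥ λ aw → ¬found (w , w∉ ∘ here , aw)

  -- A second centre of any colour leads back to `distinctCentres`. Otherwise `manyOff`, applied to
  -- all three pairs, shows that at least two colours have many edges off `v`; these supply the
  -- matchings.
  commonCentre : Rainbow a b c → Star a v → Star b v → Star c v → Goal
  commonCentre {a} {b} {c} {v} abc av bv cv with otherCentre? a v | otherCentre? b v | otherCentre? c v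
  ... | inj₁ (w , w≢v , aw) | _ | _ = distinctCentres abc w≢v aw bv cv
  ... | inj₂ _ | inj₁ (w , w≢v , bw) | _ = distinctCentres abc (w≢v ∘ sym) av bw cv
  ... | inj₂ _ | inj₂ _ | inj₁ (w , w≢v , cw) = distinctCentres (swap₂₃ abc) (w≢v ∘ sym) av cw bv
  ... | inj₂ aLow | inj₂ bLow | inj₂ cLow
    with manyOff (rainbow⇒≢ abc) v | manyOff (rainbow⇒≢ (swap₂₃ abc)) v
       | manyOff (rainbow⇒≢ (swap₂₃ (swap₁₂ abc))) v
  ...   | inj₁ aMany | _ | inj₁ bMany = starTwoMatchings abc av bv cv aLow aMany bLow bMany
  ...   | inj₁ aMany | _ | inj₂ cMany = starTwoMatchings (swap₂₃ abc) av cv bv aLow aMany cLow cMany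
  ...   | inj₂ bMany | inj₁ aMany | _ = starTwoMatchings abc av bv cv aLow aMany bLow bMany
  ...   | inj₂ bMany | inj₂ cMany | _ = starTwoMatchings (swap₂₃ (swap₁₂ abc)) bv cv av bLow bMany cLow cMany

  manyOfEachColour⇒balancedP6 : Goal
  manyOfEachColour⇒balancedP6 = search abc (source zero) (source (suc zero)) (source (suc (suc zero)))
    where
    abc : Rainbow zero (suc zero) (suc (suc zero))
    abc = ((λ ()) ∷ (λ ()) ∷ []) ∷ ((λ ()) ∷ []) ∷ [] ∷ []
    search : Rainbow a b c → Source a [] ⊎ ∃[ v ] Star a v → Source b [] ⊎ ∃[ v ] Star b v →
             Source c [] ⊎ ∃[ v ] Star c v → Goal
    search abc (inj₁ sa) _ _ = oneLow (swap₂₃ (swap₁₂ abc)) sa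
    search abc (inj₂ _) (inj₁ sb) _ = oneLow (swap₂₃ abc) sb
    search abc (inj₂ _) (inj₂ _) (inj₁ sc) = oneLow abc sc
    search abc (inj₂ (u , au)) (inj₂ (v , bv)) (inj₂ (w , cw)) with u ≟ v | u ≟ w
    ... | no u≢v | _ = distinctCentres abc u≢v au bv cw
    ... | yes refl | no u≢w = distinctCentres (swap₂₃ abc) u≢w au cw bv
    ... | yes refl | yes refl = commonCentre abc au bv cw

pattern red   = zero
pattern blue  = suc zero
pattern green = suc (suc zero)

-- The lower bound

spoke : ∀ {m} → ℕ → Fin m → Fin 3
spoke h j with toℕ j <? h
... | yes _ = blue
... | no  _ = green

spoke-blue : ∀ {m} h (j : Fin m) → toℕ j < h → spoke h j ≡ blue
spoke-blue h j j<h with toℕ j <? h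
... | yes _ = refl
... | no j≮h = contradiction j<h j≮h

spoke-green : ∀ {m} h (j : Fin m) → h ≤ toℕ j → spoke h j ≡ green
spoke-green h j h≤j with toℕ j <? h
... | yes j<h = contradiction h≤j (<⇒≱ j<h)
... | no _ = refl

splitStar : ∀ m → ℕ → Colouring (suc m)
splitStar m h = colour , symmetric
  where
  colour : Fin (suc m) → Fin (suc m) → Fin 3
  colour zero    zero    = red
  colour zero    (suc j) = spoke h j
  colour (suc i) zero    = spoke h i
  colour (suc i) (suc j) = red
  symmetric : ∀ i j → colour i j ≡ colour j i
  symmetric zero    zero    = refl
  symmetric zero    (suc j) = refl
  symmetric (suc i) zero    = refl
  symmetric (suc i) (suc j) = refl

splitStar-spoke : ∀ m h i j → proj₁ (splitStar m h) i j ≢ red → i ≡ zero ⊎ j ≡ zero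
splitStar-spoke m h zero    j       _     = inj₁ refl
splitStar-spoke m h (suc i) zero    _     = inj₂ refl
splitStar-spoke m h (suc i) (suc j) ¬red = contradiction refl ¬red

-- Only pairs with the smaller vertex first are counted, so the fan of edges is required to start at
-- its least vertex.
colourCount≥ : ∀ {n} (colouring : Colouring n) a {k} (x : Fin n) (y : Fin k → Fin n) →
               (∀ {i j} → y i ≡ y j → i ≡ j) → (∀ i → x Fin.< y i) →
               (∀ i → proj₁ colouring x (y i) ≡ a) → k ≤ colourCount colouring a
colourCount≥ {n} colouring a {k} x y y-inj x<y coloured =
  subst (_≤ colourCount colouring a) (length-tabulate edge)
    (unique-⊆⇒length≤ (tabulate⁺ {f = edge} (y-inj ∘ ,-injectiveʳ)) into)
  where
  edge : Fin k → Fin n × Fin n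
  edge i = x , y i
  into : ∀ {e} → e ∈ tabulate edge → e ∈ Graph.edges colouring a
  into e∈ with i , refl ← ∈-tabulate⁻ {f = edge} e∈ =
    ∈-filter⁺ _ (∈-cartesianProduct⁺ (∈-allFin x) (∈-allFin (y i))) (x<y i , coloured i)

-- For red, the edges from vertex 1 to the `m` vertices after it are enough. Blue uses the first `h`
-- spokes and green the next `h`, which exist because 2h is at most the number of spokes.
splitStar-large : ∀ m h → h + h ≤ suc m → ∀ a → h ≤ colourCount (splitStar (suc m) h) a
splitStar-large m h 2h≤m red = ≤-trans (h≤m h 2h≤m) 
  (colourCount≥ (splitStar (suc m) h) red (suc zero) (λ i → suc (suc i))
    (suc-injective ∘ suc-injective) (λ _ → s≤s (s≤s z≤n)) (λ _ → refl))
  where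
  h≤m : ∀ h → h + h ≤ suc m → h ≤ m
  h≤m zero _ = z≤n
  h≤m (suc h) (s≤s le) = ≤-trans (≤-trans (s≤s (m≤m+n h h)) (≤-reflexive (sym (+-suc h h)))) le
splitStar-large m h 2h≤m blue = colourCount≥ (splitStar (suc m) h) blue zero (λ i → suc (inject≤ i h≤))
    (inject≤-injective h≤ h≤ _ _ ∘ suc-injective) (λ _ → s≤s z≤n)
    (λ i → spoke-blue h (inject≤ i h≤) (subst (_< h) (sym (toℕ-inject≤ i h≤)) (toℕ<n i)))
  where
  h≤ : h ≤ suc m
  h≤ = ≤-trans (m≤m+n h h) 2h≤m
splitStar-large m h 2h≤m green = colourCount≥ (splitStar (suc m) h) green zero (λ i → suc (shift i))
    (λ eq → toℕ-injective (+-cancelˡ-≡ h _ _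
      (trans (sym (toℕ-shift _)) (trans (cong toℕ (suc-injective eq)) (toℕ-shift _)))))
    (λ _ → s≤s z≤n)
    (λ i → spoke-green h (shift i) (subst (h ≤_) (sym (toℕ-shift i)) (m≤m+n h (toℕ i))))
  where
  shift< : ∀ (i : Fin h) → h + toℕ i < suc m
  shift< i = ≤-trans (+-monoʳ-< h (toℕ<n i)) 2h≤m
  shift : Fin h → Fin (suc m)
  shift i = fromℕ< (shift< i)
  toℕ-shift : ∀ i → toℕ (shift i) ≡ h + toℕ i
  toℕ-shift i = toℕ-fromℕ< (shift< i)

incident? : (p : Fin 7) → ∀ i → Dec (inject₁ i ≡ p ⊎ suc i ≡ p)
incident? p i = (inject₁ i ≟ p) ⊎-dec (suc i ≟ p)

incident≤2 : ∀ p → length (filter (incident? p) (allFin 6)) ≤ 2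
incident≤2 = toWitness {a? = all? λ p → length (filter (incident? p) (allFin 6)) ≤? 2} tt

-- A blue step shows that the hub lies on the path, at one position `p` by injectivity. The four
-- blue and green steps would all be incident to `p`, but at most two steps are.
splitStar-noBalancedP6 : ∀ m h → ¬ HasBalancedP6 (splitStar m h)
splitStar-noBalancedP6 m h (v , v-inj , twice) = 4≰2 (hub someBlue)
  where
  step : Fin 6 → Fin 3
  step i = proj₁ (splitStar m h) (v (inject₁ i)) (v (suc i))
  steps : Fin 3 → List (Fin 6)
  steps a = filter (λ i → step i ≟ a) (allFin 6)
  steps! : ∀ a → Unique (steps a)
  steps! a = filter⁺ (λ i → step i ≟ a) (allFin⁺ 6)
  ∈-steps⁻ : ∀ a {i} → i ∈ steps a → step i ≡ a
  ∈-steps⁻ a = proj₂ ∘ ∈-filter⁻ (λ i → step i ≟ a) {xs = allFin 6}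
  someBlue : ∃[ i ] step i ≡ blue
  someBlue with steps blue in eq | twice blue
  ... | i ∷ _ | _ = i , ∈-steps⁻ blue (subst (i ∈_) (sym eq) (here refl))
  hub : (∃[ i ] step i ≡ blue) → ∃[ p ] v p ≡ zero
  hub (i , eq) with splitStar-spoke m h (v (inject₁ i)) (v (suc i)) (λ r → contradiction (trans (sym eq) r) λ ())
  ... | inj₁ z = _ , z
  ... | inj₂ z = _ , z
  4≰2 : ∃[ p ] v p ≡ zero → ⊥
  4≰2 (p , vp≡0) = contradiction (begin
      4                                         ≡⟨ cong₂ _+_ (twice blue) (twice green) ⟨
      length (steps blue) + length (steps green)  ≡⟨ length-++ (steps blue) ⟨
      length (steps blue ++ steps green)          ≤⟨ unique-⊆⇒length≤ (++⁺ (steps! blue) (steps! green) disjoint) into ⟩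
      length (filter (incident? p) (allFin 6))  ≤⟨ incident≤2 p ⟩
      2                                         ∎) λ { (s≤s (s≤s ())) }
    where
    open ≤-Reasoning
    disjoint : ∀ {i} → ¬ (i ∈ steps blue × i ∈ steps green)
    disjoint (∈b , ∈g) with () ← trans (sym (∈-steps⁻ blue ∈b)) (∈-steps⁻ green ∈g)
    incident : ∀ {i} → step i ≢ red → inject₁ i ≡ p ⊎ suc i ≡ p
    incident {i} ¬red with splitStar-spoke m h (v (inject₁ i)) (v (suc i)) ¬red
    ... | inj₁ z = inj₁ (v-inj (trans z (sym vp≡0)))
    ... | inj₂ z = inj₂ (v-inj (trans z (sym vp≡0)))
    into : ∀ {i} → i ∈ steps blue ++ steps green → i ∈ filter (incident? p) (allFin 6)
    into {i} i∈ = ∈-filter⁺ (incident? p) (∈-allFin i)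
      (incident ([ notRed blue (λ ()) , notRed green (λ ()) ]′ (∈-++⁻ (steps blue) i∈)))
      where
      notRed : ∀ a → a ≢ red → i ∈ steps a → step i ≢ red
      notRed a a≢red i∈a eq = a≢red (trans (sym (∈-steps⁻ a i∈a)) eq)

¬BalBound : ∀ m h m' → h + h ≤ suc m → m' < h → ¬ BalBound (suc (suc m)) m'
¬BalBound m h m' 2h≤m m'<h bound =
  splitStar-noBalancedP6 (suc m) h (bound (splitStar (suc m) h) (λ a → ≤-trans m'<h (splitStar-large m h 2h≤m a)))

-- Decidability of the bound

module _ {m n : ℕ} {P : (Fin m → Fin n) → Set} (P? : ∀ f → Dec (P f))
         (resp : ∀ {f g} → f ≗ g → P f → P g) where

  -- Functions are enumerated through their codes in a finite type. Decoding returns a function only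
  -- up to pointwise equality, which is why `P` must respect it.
  anyFunction? : Dec (∃[ f ] P f)
  anyFunction? = map′ (λ (i , Pi) → finToFun i , Pi)
                      (λ (f , Pf) → funToFin f , resp (sym ∘ finToFun-funToFin f) Pf)
                      (any? (λ i → P? (finToFun i)))

  allFunctions? : Dec (∀ f → P f)
  allFunctions? = map′ (λ all f → resp (finToFun-funToFin f) (all (funToFin f)))
                       (λ all i → all (finToFun i))
                       (all? (λ i → P? (finToFun i)))

Symmetric : ∀ {n} → (Fin n → Fin n → Fin 3) → Set
Symmetric c = ∀ i j → c i j ≡ c j i

module _ {n : ℕ} where

  BalancedP6Along : (Fin n → Fin n → Fin 3) → (Fin 7 → Fin n) → Set
  BalancedP6Along c v = Injective _≡_ _≡_ v ×
    (∀ a → length (filter (λ i → c (v (inject₁ i)) (v (suc i)) ≟ a) (allFin 6)) ≡ 2)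

  BalancedP6Along-resp : ∀ {c c′ v v′} → (∀ i j → c i j ≡ c′ i j) → v ≗ v′ →
                         BalancedP6Along c v → BalancedP6Along c′ v′
  BalancedP6Along-resp {c} {c′} {v} {v′} c≗c′ v≗v′ (v-inj , twice) =
    (λ {i} {j} eq → v-inj (trans (v≗v′ i) (trans eq (sym (v≗v′ j))))) ,
    λ a → trans (cong length (filter-≐ (λ i → c′ (v′ (inject₁ i)) (v′ (suc i)) ≟ a)
                                       (λ i → c (v (inject₁ i)) (v (suc i)) ≟ a)
                   ((λ {i} → trans (step i)) , (λ {i} → trans (sym (step i)))) (allFin 6))) (twice a)
    where
    step : ∀ i → c (v (inject₁ i)) (v (suc i)) ≡ c′ (v′ (inject₁ i)) (v′ (suc i))
    step i = trans (c≗c′ _ _) (cong₂ c′ (v≗v′ _) (v≗v′ _))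

  balancedP6Along? : ∀ c v → Dec (BalancedP6Along c v)
  balancedP6Along? c v =
    map′ (λ inj {i} {j} → inj i j) (λ inj i j → inj {i} {j}) (all? λ i → all? λ j → (v i ≟ v j) →-dec (i ≟ j))
    ×-dec all? (λ a → length (filter (λ i → c (v (inject₁ i)) (v (suc i)) ≟ a) (allFin 6)) ℕ.≟ 2)

  hasBalancedP6? : ∀ colouring → Dec (HasBalancedP6 {n} colouring)
  hasBalancedP6? (c , _) = anyFunction? (balancedP6Along? c) (BalancedP6Along-resp {c} {c} (λ _ _ → refl))

  colourCount-cong : ∀ {(c , s) (c′ , s′) : Colouring n} → (∀ i j → c i j ≡ c′ i j) →
                     ∀ a → colourCount (c , s) a ≡ colourCount (c′ , s′) a
  colourCount-cong c≗c′ a = cong length (filter-≐ _ _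
    ((λ {(i , j)} (i<j , eq) → i<j , trans (sym (c≗c′ i j)) eq) ,
     (λ {(i , j)} (i<j , eq) → i<j , trans (c≗c′ i j) eq)) (cartesianProduct (allFin n) (allFin n)))

  -- The symmetry proof becomes a hypothesis, so that the enumeration runs over plain colour
  -- functions.
  BoundAt : ℕ → (Fin n → Fin n → Fin 3) → Set
  BoundAt m c = (s : Symmetric c) → (∀ a → m < colourCount (c , s) a) → HasBalancedP6 (c , s)

  BoundAt-resp : ∀ {m c c′} → (∀ i j → c i j ≡ c′ i j) → BoundAt m c → BoundAt m c′
  BoundAt-resp {m} {c} {c′} c≗c′ bound s large =
    map₂ (λ {v} → BalancedP6Along-resp {c} {c′} {v} {v} c≗c′ (λ _ → refl))
      (bound sym-c λ a → subst (m <_) (sym (colourCount-cong {c , sym-c} {c′ , s} c≗c′ a)) (large a))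
    where
    sym-c : Symmetric c
    sym-c i j = trans (c≗c′ i j) (trans (s i j) (sym (c≗c′ j i)))

  -- A function that is not symmetric satisfies the bound vacuously. For a symmetric one, neither
  -- the counts nor the path depend on the symmetry proof, so one proof decides for all.
  boundAt? : ∀ m c → Dec (BoundAt m c)
  boundAt? m c with all? (λ i → all? λ j → c i j ≟ c j i)
  ... | no ¬s = yes λ s → contradiction s ¬s
  ... | yes s with all? (λ a → m <? colourCount (c , s) a)
  ...   | no ¬large = yes λ s′ large → contradiction large ¬large
  ...   | yes large = map′ (λ has _ _ → has) (λ bound → bound s large) (hasBalancedP6? (c , s))

  -- The enumeration has two levels: each row of the colouring is coded as a number, and a colouring
  -- is a function from vertices to row codes.
  balBound? : ∀ m → Dec (BalBound n m)
  balBound? m = map′ (λ all (c , s) → BoundAt-resp {m} (λ i j → finToFun-funToFin (c i) j) (all (funToFin ∘ c)) s)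
                     (λ bound rows s → bound ((λ i → finToFun (rows i)) , s))
                     (allFunctions? (λ rows → boundAt? m (λ i → finToFun (rows i)))
                        (λ f≗g → BoundAt-resp {m} (λ i j → cong (λ row → finToFun row j) (f≗g i))))

-- The minimum and its asymptotics

least : ∀ {P : ℕ → Set} → (∀ m → Dec (P m)) → ∀ {u} → P u →
        ∃[ m ] (m ≤ u × P m × (∀ m' → m' < m → ¬ P m'))
least {P} P? {u} = <-rec (λ u → P u → ∃[ m ] (m ≤ u × P m × (∀ m' → m' < m → ¬ P m'))) step u
  where
  step : ∀ u → (∀ {w} → w < u → P w → ∃[ m ] (m ≤ w × P m × (∀ m' → m' < m → ¬ P m'))) →
         P u → ∃[ m ] (m ≤ u × P m × (∀ m' → m' < m → ¬ P m'))
  step u rec Pu with anyUpTo? P? u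
  ... | no none = u , ≤-refl , Pu , λ m' m'<u Pm' → none (m' , m'<u , Pm')
  ... | yes (w , w<u , Pw) with m , m≤w , rest ← rec w<u Pw = m , ≤-trans m≤w (<⇒≤ w<u) , rest

n≤1+2⌊n/2⌋ : ∀ n → n ≤ suc (⌊ n /2⌋ + ⌊ n /2⌋)
n≤1+2⌊n/2⌋ zero = z≤n
n≤1+2⌊n/2⌋ (suc zero) = s≤s z≤n
n≤1+2⌊n/2⌋ (suc (suc n)) = s≤s (≤-trans (s≤s (n≤1+2⌊n/2⌋ n)) (≤-reflexive (cong suc (sym (+-suc ⌊ n /2⌋ ⌊ n /2⌋)))))

2⌊n/2⌋≤n : ∀ n → ⌊ n /2⌋ + ⌊ n /2⌋ ≤ n
2⌊n/2⌋≤n n = ≤-trans (+-monoʳ-≤ ⌊ n /2⌋ (⌊n/2⌋≤⌈n/2⌉ n)) (≤-reflexive (⌊n/2⌋+⌈n/2⌉≡n n))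

balBound-upper : ∀ n → BalBound n (⌊ n /2⌋ + S)
balBound-upper n colouring large = manyOfEachColour⇒balancedP6 colouring λ a → begin
  n + (S + S)                                           ≤⟨ +-monoˡ-≤ (S + S) (n≤1+2⌊n/2⌋ n) ⟩
  suc (h + h) + (S + S)                                 ≡⟨ cong suc (interchange +-commutativeSemigroup h h S S) ⟩
  -- The hypothesis is strict; the unit gained from one of its two uses pays for rounding n/2 down.
  suc ((h + S) + (h + S))                               ≤⟨ +-mono-≤ (large a) (<⇒≤ (large a)) ⟩
  colourCount colouring a + colourCount colouring a     ∎
  where
  open ≤-Reasoning
  h = ⌊ n /2⌋

-- The explicit form of the result: the minimum lies between n/2 - 1 and n/2 + S.
bal₃P₆-bounds : ∀ n → 2 ≤ n → ∃[ m ] (IsBal3P6 n m × 2 * m ≤ n + 2 * S × n ≤ 2 * m + 2)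
bal₃P₆-bounds zero ()
bal₃P₆-bounds (suc zero) (s≤s ())
bal₃P₆-bounds (suc (suc k)) _ = bounds (least balBound? (balBound-upper n))
  where
  open ≤-Reasoning
  n = suc (suc k)
  -- One of the k + 2 vertices is the hub, and its k + 1 spokes are halved.
  h = ⌊ suc k /2⌋
  upper : ∀ {m} → m ≤ ⌊ n /2⌋ + S → 2 * m ≤ n + 2 * S
  upper {m} m≤ = begin
    2 * m                       ≤⟨ *-monoʳ-≤ 2 m≤ ⟩
    2 * (⌊ n /2⌋ + S)           ≡⟨ *-distribˡ-+ 2 ⌊ n /2⌋ S ⟩
    2 * ⌊ n /2⌋ + 2 * S         ≡⟨ cong (λ t → ⌊ n /2⌋ + t + 2 * S) (+-identityʳ ⌊ n /2⌋) ⟩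
    ⌊ n /2⌋ + ⌊ n /2⌋ + 2 * S   ≤⟨ +-monoˡ-≤ (2 * S) (2⌊n/2⌋≤n n) ⟩
    n + 2 * S                   ∎
  lower : ∀ {m} → h ≤ m → n ≤ 2 * m + 2
  lower {m} h≤m = begin
    n                     ≤⟨ s≤s (n≤1+2⌊n/2⌋ (suc k)) ⟩
    2 + (h + h)           ≤⟨ +-monoʳ-≤ 2 (+-mono-≤ h≤m h≤m) ⟩
    2 + (m + m)           ≡⟨ +-comm 2 (m + m) ⟩
    m + m + 2             ≡⟨ cong (λ t → m + t + 2) (+-identityʳ m) ⟨
    2 * m + 2             ∎
  bounds : ∃[ m ] (m ≤ ⌊ n /2⌋ + S × BalBound n m × (∀ m' → m' < m → ¬ BalBound n m')) →
           ∃[ m ] (IsBal3P6 n m × 2 * m ≤ n + 2 * S × n ≤ 2 * m + 2)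
  bounds (m , m≤ , bound , minimal) =
    m , (bound , minimal) , upper m≤ ,
    lower (≮⇒≥ λ m<h → ¬BalBound k h m (2⌊n/2⌋≤n (suc k)) m<h bound)

-- The o(1) term is tested against 1/(k+1): divided by 2n(k+1), the two inequalities say that m/n
-- differs from 1/2 by at most 1/(k+1).
theorem1p11 : ∀ (k : ℕ) → ∃[ N ] ∀ (n : ℕ) → N ≤ n →
    ∃[ m ] (IsBal3P6 n m ×
    (suc k * (2 * m) ≤ suc k * n + 2 * n) ×
    (suc k * n ≤ suc k * (2 * m) + 2 * n))
-- From this threshold on, (k+1)S is at most n, which absorbs the upper error 2S(k+1); the lower
-- error 2(k+1) is smaller still.
theorem1p11 k = suc k * S , λ n N≤n →
  let m , isBal , upper , lower = bal₃P₆-bounds n (≤-trans (≤-trans (≤ᵇ⇒≤ 2 S tt) (m≤m+n S (k * S))) N≤n)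
      open ≤-Reasoning in
  m , isBal ,
  (begin
    suc k * (2 * m)               ≤⟨ *-monoʳ-≤ (suc k) upper ⟩
    suc k * (n + 2 * S)           ≡⟨ *-distribˡ-+ (suc k) n (2 * S) ⟩
    suc k * n + suc k * (2 * S)   ≡⟨ cong (suc k * n +_) (x∙yz≈y∙xz *-commutativeSemigroup (suc k) 2 S) ⟩
    suc k * n + 2 * (suc k * S)   ≤⟨ +-monoʳ-≤ (suc k * n) (*-monoʳ-≤ 2 N≤n) ⟩
    suc k * n + 2 * n             ∎) ,
  (begin
    suc k * n                     ≤⟨ *-monoʳ-≤ (suc k) lower ⟩
    suc k * (2 * m + 2)           ≡⟨ *-distribˡ-+ (suc k) (2 * m) 2 ⟩
    suc k * (2 * m) + suc k * 2   ≡⟨ cong (suc k * (2 * m) +_) (*-comm (suc k) 2) ⟩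
    suc k * (2 * m) + 2 * suc k   ≤⟨ +-monoʳ-≤ (suc k * (2 * m)) (*-monoʳ-≤ 2 (≤-trans (m≤m*n (suc k) S) N≤n)) ⟩
    suc k * (2 * m) + 2 * n       ∎)
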